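{- Let $Q=T[H_1,\dots,H_t]$ be a strong semicomplete composition, where $H_i$ has $n_i$ vertices. Then $Q$ has a Hamiltonian cycle if and only if the extended semicomplete digraph $Q'=T[\overline{K}_{n_1},\dots,\overline{K}_{n_t}]$ has a cycle subdigraph which covers at least $pc(H_i)$ vertices of $\overline{K}_{n_i}$ for every $i\in\{1,\dots,t\}$.
   Context: Digraphs are finite, without loops or parallel arcs (2-cycles are allowed); paths and cycles are directed, a single vertex is a path, and cycles have length at least 2. A digraph is semicomplete if there is at least one arc between every pair of distinct vertices. Let $T$ be a digraph with vertices $u_1,\dots,u_t$ ($t\ge 2$) and let $H_1,\dots,H_t$ be pairwise disjoint nonempty digraphs. The composition $Q=T[H_1,\dots,H_t]$ is the digraph with vertex set $\bigcup_i V(H_i)$ and arc set $\bigcup_{i=1}^t A(H_i)\cup\{xy : x\in V(H_i),\ y\in V(H_p),\ u_iu_p\in A(T)\}$. It is a semicomplete composition if $T$ is semicomplete. $\overline{K}_p$ denotes the digraph of order $p$ with no arcs. A digraph is strong if for every ordered pair of vertices $(x,y)$ there is a directed path from $x$ to $y$. A cycle subdigraph of $D$ is a collection of pairwise vertex-disjoint cycles of $D$. The path covering number $pc(D)$ is the smallest $k$ such that $V(D)$ can be covered by $k$ pairwise vertex-disjoint paths of $D$. A Hamiltonian cycle is a cycle containing all vertices. -}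

module Defs where

open import Level using (0ℓ)
open import Data.Empty using (⊥)
open import Data.Fin using (Fin; zero; suc)
open import Data.Fin.Properties using (+↔⊎; inj⇒≟; injective⇒≤)
open import Data.List using (List; []; _∷_; [_]; _∷ʳ_; length; head; last; lookup; map; tabulate; filter; allFin; upTo; concatMap; cartesianProductWith)
open import Data.List.Membership.Propositional using (_∈_; find; lose)
open import Data.List.Membership.Propositional.Properties using (∈-allFin; ∈-map⁺; ∈-upTo⁺; ∈-concatMap⁺; ∈-cartesianProductWith⁺; ∈-lookup)
open import Data.List.Relation.Binary.Disjoint.Propositional using (Disjoint)
open import Data.List.Relation.Unary.All as All using (All; []; _∷_; all?)
open import Data.List.Relation.Unary.All.Properties as Allₚ using ()
open import Data.List.Relation.Unary.AllPairs as AllPairs using (AllPairs; []; _∷_; allPairs?)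
open import Data.List.Relation.Unary.AllPairs.Properties as AllPairsₚ using ()
open import Data.List.Relation.Unary.Any as Any using (Any; here; any?)
open import Data.List.Relation.Unary.Any.Properties as Anyₚ using ()
open import Data.List.Relation.Unary.Linked using (Linked; [-]; linked?)
open import Data.List.Relation.Unary.Unique.Propositional using (Unique)
open import Data.List.Relation.Unary.Unique.Propositional.Properties as Uniqueₚ using ()
open import Data.Maybe using (just)
open import Data.Nat using (ℕ; zero; suc; _≤_; z≤n; s≤s; _≤?_)
open import Data.Nat.ListAction using (sum)
open import Data.Nat.Properties using (≤-refl) renaming (_≟_ to _≟ℕ_)
open import Data.Product using (Σ; ∃; ∃-syntax; _×_; _,_; proj₁; proj₂)
open import Data.Product.Function.Dependent.Propositional using (Σ-↔)
open import Data.Sum using (_⊎_; inj₁; inj₂)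
open import Data.Sum.Function.Propositional using (_⊎-↔_)
open import Function using (_∘_; _↔_; mk↔ₛ′; Inverse; Injection)
open import Function.Properties.Inverse using (↔-refl; ↔-sym; ↔-trans; ↔⇒↣)
open import Relation.Binary using (Rel; DecidableEquality; Decidable)
open import Relation.Binary.PropositionalEquality using (_≡_; _≢_; refl; sym; cong; subst)
open import Relation.Nullary using (¬_; yes; no; contradiction)
open import Relation.Nullary.Decidable using (map′; _×-dec_)
import Relation.Unary as U
import Data.List.Membership.DecPropositional as DecMembership
import Data.List.Relation.Binary.Disjoint.DecPropositional as DecDisjoint
import Data.List.Relation.Unary.Unique.DecPropositional as DecUnique

-- Arc is a relation, so there are no parallel arcs; 2-cycles are allowed.
-- Decidability of Arc is automatic classically for a finite digraph.
record Digraph : Set₁ where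
  field
    V       : Set
    order   : ℕ
    enum    : V ↔ Fin order
    Arc     : Rel V 0ℓ
    arc?    : Decidable Arc
    no-loop : ∀ v → ¬ Arc v v

  infix 4 _≟_
  _≟_ : DecidableEquality V
  _≟_ = inj⇒≟ (↔⇒↣ enum)

  vertices : List V
  vertices = map (Inverse.from enum) (allFin order)

  open DecMembership _≟_ public using (_∈?_)
  open DecDisjoint _≟_ public using (disjoint?)
  open DecUnique _≟_ public using (unique?)

open Digraph public using (V; order)

-- The vertex list of a directed path; a single vertex is a path.
record IsPath (D : Digraph) (p : List (V D)) : Set where
  constructor mkPath
  field
    nonempty : 1 ≤ length p
    arcs     : Linked (Digraph.Arc D) p
    distinct : Unique p

-- x ∷ xs lists the vertices of a directed cycle, starting anywhere on it; the
-- arc from the last vertex back to x is the final link of x ∷ xs ∷ʳ x.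
data IsCycle (D : Digraph) : List (V D) → Set where
  mkCycle : ∀ {x xs} →
            2 ≤ length (x ∷ xs) →
            Unique (x ∷ xs) →
            Linked (Digraph.Arc D) (x ∷ xs ∷ʳ x) →
            IsCycle D (x ∷ xs)

Semicomplete : Digraph → Set
Semicomplete D = ∀ u v → u ≢ v → Arc u v ⊎ Arc v u
  where open Digraph D using (Arc)

Strong : Digraph → Set
Strong D = ∀ x y → ∃[ p ] (IsPath D p × head p ≡ just x × last p ≡ just y)

HasHamiltonianCycle : Digraph → Set
HasHamiltonianCycle D = ∃[ c ] (IsCycle D c × (∀ v → v ∈ c))

IsCycleSubdigraph : (D : Digraph) → List (List (V D)) → Set
IsCycleSubdigraph D cs = All (IsCycle D) cs × AllPairs Disjoint cs

record IsPathCover (D : Digraph) (ps : List (List (V D))) : Set where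
  constructor mkPathCover
  field
    paths    : All (IsPath D) ps
    disjoint : AllPairs Disjoint ps
    covers   : ∀ v → Any (v ∈_) ps

PathCoverable : Digraph → ℕ → Set
PathCoverable D k = ∃[ ps ] (length ps ≡ k × IsPathCover D ps)

IsSmallest : (ℕ → Set) → ℕ → Set
IsSmallest P k = P k × (∀ j → P j → k ≤ j)

smallest : {P : ℕ → Set} → U.Decidable P → ∀ n → P n → ∃ (IsSmallest P)
smallest     P? zero    p = 0 , p , λ _ _ → z≤n
smallest {P} P? (suc n) p with P? 0
... | yes p₀ = 0 , p₀ , λ _ _ → z≤n
... | no ¬p₀ with smallest {P ∘ suc} (P? ∘ suc) n p
...   | k , pk , min = suc k , pk , λ { zero    p₀ → contradiction p₀ ¬p₀
                                      ; (suc j) pj → s≤s (min j pj) }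

listsOf : {A : Set} → List A → ℕ → List (List A)
listsOf L zero    = [ [] ]
listsOf L (suc n) = cartesianProductWith _∷_ L (listsOf L n)

∈-listsOf : {A : Set} {L : List A} {xs : List A} →
            All (_∈ L) xs → xs ∈ listsOf L (length xs)
∈-listsOf []         = here refl
∈-listsOf (x∈ ∷ xs∈) = ∈-cartesianProductWith⁺ _∷_ x∈ (∈-listsOf xs∈)

lookup-injective : {A : Set} {xs : List A} → Unique xs →
                   ∀ {i j} → lookup xs i ≡ lookup xs j → i ≡ j
lookup-injective (_ ∷ _)  {zero}  {zero}  _  = refl
lookup-injective (x∉ ∷ _) {zero}  {suc j} eq =
  contradiction eq (All.lookup x∉ (∈-lookup j))
lookup-injective (x∉ ∷ _) {suc i} {zero}  eq =
  contradiction (sym eq) (All.lookup x∉ (∈-lookup i))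
lookup-injective (_ ∷ u)  {suc i} {suc j} eq = cong suc (lookup-injective u eq)

module _ (D : Digraph) where
  open Digraph D using (arc?; enum; vertices; _∈?_; disjoint?; unique?)

  ∈-vertices : ∀ v → v ∈ vertices
  ∈-vertices v = subst (_∈ vertices) (Inverse.strictlyInverseʳ enum v)
    (∈-map⁺ (Inverse.from enum) (∈-allFin (Inverse.to enum v)))

  vertices-unique : Unique vertices
  vertices-unique = Uniqueₚ.map⁺ (Injection.injective (↔⇒↣ (↔-sym enum))) (Uniqueₚ.allFin⁺ (order D))

  unique⇒length≤order : {xs : List (V D)} → Unique xs → length xs ≤ order D
  unique⇒length≤order u = injective⇒≤ (lookup-injective u ∘ Injection.injective (↔⇒↣ enum))

  -- Every path occurs here, so path covers can be searched for exhaustively.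
  candidates : List (List (V D))
  candidates = concatMap (listsOf vertices) (upTo (suc (order D)))

  path∈candidates : ∀ {p} → IsPath D p → p ∈ candidates
  path∈candidates {p} isPath = ∈-concatMap⁺ (listsOf vertices)
    (lose (∈-upTo⁺ (s≤s (unique⇒length≤order (IsPath.distinct isPath))))
          (∈-listsOf (All.universal ∈-vertices p)))

  isPath? : U.Decidable (IsPath D)
  isPath? p = map′ (λ (a , b , c) → mkPath a b c)
                   (λ (mkPath a b c) → a , b , c)
                   ((1 ≤? length p) ×-dec linked? arc? p ×-dec unique? p)

  isPathCover? : U.Decidable (IsPathCover D)
  isPathCover? ps = map′
    (λ (a , b , c) → mkPathCover a b (λ v → All.lookup c (∈-vertices v)))
    (λ (mkPathCover a b c) → a , b , All.universal c vertices)
    (all? isPath? ps ×-dec allPairs? disjoint? ps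
      ×-dec all? (λ v → any? (v ∈?_) ps) vertices)

  pathCoverable? : U.Decidable (PathCoverable D)
  pathCoverable? k = map′
    (λ found → let ps , _ , ok = find found in ps , ok)
    (λ { (ps , refl , cover) →
         lose (∈-listsOf (All.map path∈candidates (IsPathCover.paths cover)))
              (refl , cover) })
    (any? (λ ps → (length ps ≟ℕ k) ×-dec isPathCover? ps) (listsOf candidates k))

  trivialPathCover : IsPathCover D (map [_] vertices)
  trivialPathCover = mkPathCover
    (Allₚ.map⁺ (All.universal (λ _ → mkPath ≤-refl [-] ([] ∷ [])) vertices))
    (AllPairsₚ.map⁺ (AllPairs.map (λ { x≢y (here refl , here refl) → x≢y refl }) vertices-unique))
    (λ v → Anyₚ.map⁺ (Any.map here (∈-vertices v)))

  smallestPathCover : ∃ (IsSmallest (PathCoverable D))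
  smallestPathCover = smallest pathCoverable? _ (_ , refl , trivialPathCover)

  pc : ℕ
  pc = proj₁ smallestPathCover

  pc-isSmallest : IsSmallest (PathCoverable D) pc
  pc-isSmallest = proj₂ smallestPathCover

ΣFin↔Fin : ∀ {t} (n : Fin t → ℕ) → Σ (Fin t) (Fin ∘ n) ↔ Fin (sum (tabulate n))
ΣFin↔Fin {zero}  n = mk↔ₛ′ (λ ()) (λ ()) (λ ()) (λ ())
ΣFin↔Fin {suc t} n = ↔-trans split (↔-trans (↔-refl ⊎-↔ ΣFin↔Fin (n ∘ suc)) (↔-sym +↔⊎))
  where
  split : Σ (Fin (suc t)) (Fin ∘ n) ↔ (Fin (n zero) ⊎ Σ (Fin t) (Fin ∘ n ∘ suc))
  split = mk↔ₛ′
    (λ { (zero , x) → inj₁ x ; (suc i , x) → inj₂ (i , x) })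
    (λ { (inj₁ x) → zero , x ; (inj₂ (i , x)) → suc i , x })
    (λ { (inj₁ x) → refl ; (inj₂ (i , x)) → refl })
    (λ { (zero , x) → refl ; (suc i , x) → refl })

module _ (T : Digraph) (H : V T → Digraph) where
  private
    module T = Digraph T
    module H u = Digraph (H u)

  data CompositionArc : Rel (Σ (V T) (V ∘ H)) 0ℓ where
    within  : ∀ {u x y} → H.Arc u x y → CompositionArc (u , x) (u , y)
    between : ∀ {u w x y} → T.Arc u w → CompositionArc (u , x) (w , y)

  compositionArc? : Decidable CompositionArc
  compositionArc? (u , x) (w , y) with T.arc? u w
  ... | yes uw = yes (between uw)
  ... | no ¬uw with u T.≟ w
  ...   | no u≢w = no λ { (within _) → u≢w refl ; (between uw) → ¬uw uw }
  ...   | yes refl = map′ within (λ { (within xy) → xy ; (between uu) → contradiction uu ¬uw })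
                          (H.arc? u x y)

  -- The dependent sum makes the vertex sets of the H u pairwise disjoint.
  composition : Digraph
  composition = record
    { V       = Σ (V T) (V ∘ H)
    ; order   = sum (tabulate (order ∘ H ∘ Inverse.from T.enum))
    ; enum    = ↔-trans (↔-sym (Σ-↔ (↔-sym T.enum) (↔-sym (H.enum _)))) (ΣFin↔Fin _)
    ; Arc     = CompositionArc
    ; arc?    = compositionArc?
    ; no-loop = λ { (u , x) (within xx) → H.no-loop u x xx
                  ; (u , x) (between uu) → T.no-loop u uu }
    }

_⟦_⟧ : (T : Digraph) → (V T → Digraph) → Digraph
_⟦_⟧ = composition

K̄ : ℕ → Digraph
K̄ p = record
  { V       = Fin p
  ; order   = p
  ; enum    = ↔-refl
  ; Arc     = λ _ _ → ⊥
  ; arc?    = λ _ _ → no λ ()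
  ; no-loop = λ _ ()
  }

-- The number of vertices of H u lying on some member of cs.
coveredIn : (T : Digraph) (H : V T → Digraph) → List (List (V (composition T H))) → V T → ℕ
coveredIn T H cs u = length (filter (λ x → any? ((u , x) ∈?_) cs) (Digraph.vertices (H u)))
  where open Digraph (composition T H) using (_∈?_)

{-# OPTIONS --safe #-}
module Submission where

-- If Q has a Hamiltonian cycle, contracting each of its maximal runs inside an
-- H u to a vertex gives one cycle of Q′; the runs inside H u form a path cover,
-- so the cycle visits part u at least pc (H u) times.
--
-- Conversely, arcs of Q′ only depend on the parts of their ends, so its cycles
-- are closed walks in T. Two closed walks joined by arcs in both directions (or
-- sharing a part) can be merged without changing the multiset of their vertices.
-- When no merging is possible, any two walks are joined in one direction only;
-- three cyclically joined walks can be concatenated, so the walks are linearly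
-- ordered, and since T is strong there is only one. It visits part u between
-- pc (H u) and order (H u) times, say m times; replacing the visits by the m
-- paths of a path cover of H u gives a Hamiltonian cycle of Q.

open import Defs
open import Data.Nat using (_≤_)
open import Data.Product using (∃-syntax; _×_)
open import Function using (_∘_; _⇔_)
open import Level using (0ℓ)
open import Data.Empty using (⊥; ⊥-elim)
open import Data.Fin as Fin using (Fin)
open import Data.Fin.Properties using (injective⇒≤)
open import Data.List using (List; []; _∷_; [_]; _∷ʳ_; _++_; length; head; last; lookup; map; filter; concat; concatMap; reverse; allFin; applyUpTo; applyDownFrom)
open import Data.List.Membership.Propositional using (_∈_; find; lose)
open import Data.List.Membership.Propositional.Properties using (∈-applyUpTo⁻; ∈-++⁻; ∈-concat⁺; ∈-concat⁺′; ∈-concat⁻; ∈-concat⁻′; ∈-concatMap⁺; ∈-concatMap⁻; ∈-filter⁺; ∈-filter⁻; ∈-lookup; ∈-map⁺; ∈-map⁻)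
open import Data.List.Properties using (++-assoc; ++-identityʳ; applyUpTo-∷ʳ; length-filter; length-map; length-reverse; length-tabulate; reverse-applyUpTo; unfold-reverse)
open import Data.List.Relation.Binary.Disjoint.Propositional using (Disjoint)
open import Data.List.Relation.Binary.Permutation.Propositional using (_↭_; ↭-refl; ↭-sym; ↭-trans; ↭-prep; ↭-reflexive; ↭⇒↭ₛ; module PermutationReasoning)
open import Data.List.Relation.Binary.Permutation.Propositional.Properties using (++⁺; ++⁺ˡ; ++⁺ʳ; ++-comm; shift; shifts; ∷↭∷ʳ; ↭-reverse; ∈-resp-↭)
import Data.List.Relation.Binary.Permutation.Setoid.Properties as Permutationₛ
open import Data.List.Relation.Binary.Sublist.Propositional using (_⊆_; []; _∷_; ⊆-refl) renaming (_∷ʳ_ to skip)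
open import Data.List.Relation.Binary.Sublist.Propositional.Properties using (All-resp-⊆)
open import Data.List.Relation.Unary.All as All using (All; []; _∷_)
open import Data.List.Relation.Unary.All.Properties as Allₚ using ()
open import Data.List.Relation.Unary.AllPairs as AllPairs using (AllPairs; []; _∷_)
open import Data.List.Relation.Unary.AllPairs.Properties as AllPairsₚ using ()
open import Data.List.Relation.Unary.Any using (Any; here; there; index; any?)
open import Data.List.Relation.Unary.Any.Properties using (lookup-index)
open import Data.List.Relation.Unary.Linked as Linked using (Linked; [-]; _∷_)
open import Data.List.Relation.Unary.Linked.Properties as Linkedₚ using ()
open import Data.List.Relation.Unary.Unique.Propositional using (Unique)
open import Data.List.Relation.Unary.Unique.Propositional.Properties as Uniqueₚ using ()
open import Data.Maybe using (just)
open import Data.Nat using (ℕ; zero; suc; _+_; _*_; _%_; _/_; _<_; _≤?_; z≤n; s≤s)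
open import Data.Nat.DivMod using (m≡m%n+[m/n]*n; m%n<n)
open import Data.Nat.Properties using (+-assoc; +-comm; +-identityʳ; +-suc; *-comm; *-suc; suc-injective; ≤-refl; ≤-reflexive; ≤-trans; ≤-antisym; ≤-pred; ≤-total; ≰⇒>; <⇒≤; m≤n⇒∃[o]m+o≡n; anyUpTo?)
open import Data.Product using (Σ; ∃; ∃₂; _,_; proj₁; proj₂)
open import Data.Sum using (_⊎_; inj₁; inj₂)
open import Function using (_↔_; flip; id; mk⇔; Injection; Inverse)
open import Function.Properties.Inverse using (↔⇒↣)
open import Relation.Binary using (DecidableEquality; Rel)
open import Relation.Binary.PropositionalEquality using (_≡_; _≢_; refl; sym; trans; cong; cong₂; setoid; subst; subst₂)
open import Relation.Nullary using (¬_; Dec; yes; no; contradiction)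
open import Relation.Nullary.Decidable using (map′; _×-dec_)
import Relation.Unary as U

-- Lists

AllPairs-resp-⊆ : ∀ {A : Set} {R : Rel A 0ℓ} {xs ys} → xs ⊆ ys → AllPairs R ys → AllPairs R xs
AllPairs-resp-⊆ []         []         = []
AllPairs-resp-⊆ (skip _ s) (_ ∷ rs)   = AllPairs-resp-⊆ s rs
AllPairs-resp-⊆ (refl ∷ s) (r ∷ rs)   = All-resp-⊆ s r ∷ AllPairs-resp-⊆ s rs

Unique-resp-↭ : ∀ {A : Set} {xs ys : List A} → xs ↭ ys → Unique xs → Unique ys
Unique-resp-↭ {A} p = Permutationₛ.Unique-resp-↭ (setoid A) (↭⇒↭ₛ p)

Unique-++⁻ : ∀ {A : Set} (xs : List A) {ys} → Unique (xs ++ ys) → Unique xs × Unique ys × Disjoint xs ys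
Unique-++⁻ []       u       = [] , u , λ { (() , _) }
Unique-++⁻ (x ∷ xs) (p ∷ u) with uxs , uys , d ← Unique-++⁻ xs u =
  Allₚ.++⁻ˡ xs p ∷ uxs , uys ,
  λ { (here refl , v∈) → All.lookup (Allₚ.++⁻ʳ xs p) v∈ refl ; (there v∈ , v∈′) → d (v∈ , v∈′) }

Unique-concat⁻ : ∀ {A : Set} (xss : List (List A)) → Unique (concat xss) → All Unique xss × AllPairs Disjoint xss
Unique-concat⁻ []         _ = [] , []
Unique-concat⁻ (xs ∷ xss) u with uxs , uxss , d ← Unique-++⁻ xs u with us , ds ← Unique-concat⁻ xss uxss =
  uxs ∷ us , All.tabulate (λ ys∈ (v∈ , v∈ys) → d (v∈ , ∈-concat⁺′ v∈ys ys∈)) ∷ ds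

unique-⊆⇒length≤ : ∀ {A : Set} {xs ys : List A} → Unique xs → (∀ {x} → x ∈ xs → x ∈ ys) → length xs ≤ length ys
unique-⊆⇒length≤ {xs = xs} {ys} u sub = injective⇒≤ {f = f} λ {i} {j} eq →
  lookup-injective u (trans (lookup-index (sub (∈-lookup i)))
    (trans (cong (lookup ys) eq) (sym (lookup-index (sub (∈-lookup j))))))
  where
  f : Fin (length xs) → Fin (length ys)
  f i = index (sub (∈-lookup i))

module Fiber {I : Set} (_≟_ : DecidableEquality I) {B : I → Set} (i : I) where

  fiber : List (Σ I B) → List (B i)
  fiber []            = []
  fiber ((j , b) ∷ l) with j ≟ i
  ... | yes refl = b ∷ fiber l
  ... | no  _    = fiber l

  ∈-fiber⁺ : ∀ {b l} → (i , b) ∈ l → b ∈ fiber l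
  ∈-fiber⁺ {l = (j , _) ∷ l} b∈ with j ≟ i
  ∈-fiber⁺ (here refl) | yes refl = here refl
  ∈-fiber⁺ (there b∈)  | yes refl = there (∈-fiber⁺ b∈)
  ∈-fiber⁺ (here refl) | no j≢i   = contradiction refl j≢i
  ∈-fiber⁺ (there b∈)  | no _     = ∈-fiber⁺ b∈

  ∈-fiber⁻ : ∀ {b} l → b ∈ fiber l → (i , b) ∈ l
  ∈-fiber⁻ ((j , _) ∷ l) b∈ with j ≟ i
  ∈-fiber⁻ (_ ∷ l) (here refl) | yes refl = here refl
  ∈-fiber⁻ (_ ∷ l) (there b∈)  | yes refl = there (∈-fiber⁻ l b∈)
  ∈-fiber⁻ (_ ∷ l) b∈          | no _     = there (∈-fiber⁻ l b∈)

  AllPairs-fiber : ∀ {R : Rel (Σ I B) 0ℓ} {l} → AllPairs R l → AllPairs (λ b b′ → R (i , b) (i , b′)) (fiber l)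
  AllPairs-fiber [] = []
  AllPairs-fiber {l = (j , _) ∷ l} (r ∷ rs) with j ≟ i
  ... | yes refl = All.tabulate (λ b∈ → All.lookup r (∈-fiber⁻ l b∈)) ∷ AllPairs-fiber rs
  ... | no _     = AllPairs-fiber rs

module Assign {K B : Set} (_≟_ : DecidableEquality K) where

  -- Keys without a partner get the empty list.
  assign : List K → List (List B) → K → List B
  assign (k ∷ ks) (p ∷ ps) x with x ≟ k
  ... | yes _ = p
  ... | no  _ = assign ks ps x
  assign _ _ _ = []

  -- Having a member `v` excludes the default empty list, which need not occur in `ps`.
  assign-∈ : ∀ ks ps {x v} → v ∈ assign ks ps x → assign ks ps x ∈ ps
  assign-∈ (k ∷ ks) (p ∷ ps) {x} v∈ with x ≟ k
  ... | yes _ = here refl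
  ... | no  _ = there (assign-∈ ks ps v∈)

  assign-all : ∀ {P : List B → Set} {ks ps x} → length ps ≡ length ks → All P ps → x ∈ ks → P (assign ks ps x)
  assign-all {ks = k ∷ ks} {p ∷ ps} {x} eq (pp ∷ pps) x∈ with x ≟ k
  assign-all eq (pp ∷ pps) x∈         | yes _ = pp
  assign-all eq (pp ∷ pps) (here x≡k) | no x≢k = contradiction x≡k x≢k
  assign-all eq (pp ∷ pps) (there x∈) | no x≢k = assign-all (suc-injective eq) pps x∈

  assign-unique : ∀ ks {ps} → All Unique ps → ∀ x → Unique (assign ks ps x)
  assign-unique []       us x = []
  assign-unique (k ∷ ks) [] x = []
  assign-unique (k ∷ ks) (u ∷ us) x with x ≟ k
  ... | yes _ = u
  ... | no  _ = assign-unique ks us x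

  assign-disjoint : ∀ ks {ps} → AllPairs Disjoint ps → ∀ {x y} → x ≢ y → Disjoint (assign ks ps x) (assign ks ps y)
  assign-disjoint [] ds x≢y (() , _)
  assign-disjoint (k ∷ ks) [] x≢y (() , _)
  assign-disjoint (k ∷ ks) {p ∷ ps} (d ∷ ds) {x} {y} x≢y (v∈ , v∈′) with x ≟ k | y ≟ k
  ... | yes refl | yes refl = x≢y refl
  ... | yes _    | no _     = All.lookup d (assign-∈ ks ps v∈′) (v∈ , v∈′)
  ... | no _     | yes _    = All.lookup d (assign-∈ ks ps v∈) (v∈′ , v∈)
  ... | no _     | no _     = assign-disjoint ks ds x≢y (v∈ , v∈′)

  -- A repeated key would always retrieve its earlier list and hide the later one; hence
  -- `Unique ks`.
  assign-covers : ∀ {ks ps v} → Unique ks → length ps ≡ length ks → v ∈ concat ps →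
                  ∃[ x ] (x ∈ ks × v ∈ assign ks ps x)
  assign-covers {k ∷ ks} {p ∷ ps} {v} (k∉ ∷ u) eq v∈ with ∈-++⁻ p v∈
  ... | inj₁ v∈p = k , here refl , found
    where
    found : v ∈ assign (k ∷ ks) (p ∷ ps) k
    found with k ≟ k
    ... | yes _   = v∈p
    ... | no  k≢k = contradiction refl k≢k
  ... | inj₂ v∈ps with x , x∈ , v∈x ← assign-covers u (suc-injective eq) v∈ps = x , there x∈ , found
    where
    found : v ∈ assign (k ∷ ks) (p ∷ ps) x
    found with x ≟ k
    ... | yes refl = contradiction refl (All.lookup k∉ x∈)
    ... | no  _    = v∈x

-- Closed walks and their periodic parametrisations

module _ {A : Set} where

  infixr 5 _∷_

  -- A walk from x to y whose intermediate vertices are listed in order.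
  data Trail (R : Rel A 0ℓ) : A → List A → A → Set where
    arc : ∀ {x y} → R x y → Trail R x [] y
    _∷_ : ∀ {x z zs y} → R x z → Trail R z zs y → Trail R x (z ∷ zs) y

  data Closed (R : Rel A 0ℓ) : List A → Set where
    closed : ∀ {x xs} → Trail R x xs x → Closed R (x ∷ xs)

  Trail-weaken : ∀ {R S : Rel A 0ℓ} → (∀ {x y} → R x y → S x y) → ∀ {x xs y} → Trail R x xs y → Trail S x xs y
  Trail-weaken f (arc r) = arc (f r)
  Trail-weaken f (r ∷ t) = f r ∷ Trail-weaken f t

  Trail-++ : ∀ {R x xs y ys z} → Trail R x xs y → Trail R y ys z → Trail R x (xs ++ y ∷ ys) z
  Trail-++ (arc r) t = r ∷ t
  Trail-++ (r ∷ s) t = r ∷ Trail-++ s t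

  Trail-reverse : ∀ {R x xs y} → Trail R x xs y → Trail (flip R) y (reverse xs) x
  Trail-reverse (arc r) = arc r
  Trail-reverse {R} {x} {z ∷ zs} {y} (r ∷ t) =
    subst (λ l → Trail (flip R) y l x) (sym (unfold-reverse z zs)) (Trail-++ (Trail-reverse t) (arc r))

  -- Only the last arc changes; asking for arcs from every vertex avoids naming the last one.
  Trail-redirect : ∀ {R x xs y z} → Trail R x xs y → (∀ {a} → a ∈ x ∷ xs → R a z) → Trail R x xs z
  Trail-redirect (arc _) f = arc (f (here refl))
  Trail-redirect (r ∷ t) f = r ∷ Trail-redirect t (f ∘ there)

  ascend : ∀ {R : Rel A 0ℓ} {f : ℕ → A} {zs y} → (∀ n → R (f n) (f (suc n))) →
           ∀ n → Trail R (f n) zs y → Trail R (f 0) (applyUpTo (f ∘ suc) n ++ zs) y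
  ascend step zero    t = t
  ascend step (suc n) t = step 0 ∷ ascend (step ∘ suc) n t

  descend : ∀ {R : Rel A 0ℓ} {f : ℕ → A} {zs y} → (∀ n → R (f (suc n)) (f n)) →
            ∀ n → Trail R (f 0) zs y → Trail R (f n) (applyDownFrom f n ++ zs) y
  descend step zero    t = t
  descend step (suc n) t = step n ∷ descend step n t

  alternate : (f g : ℕ → A) → ℕ → List A
  alternate f g zero    = []
  alternate f g (suc n) = f 0 ∷ g 0 ∷ alternate (f ∘ suc) (g ∘ suc) n

  alternate-trail : ∀ {R : Rel A 0ℓ} {f g : ℕ → A} {x} →
                    (∀ n → R (f n) (g n)) → (∀ n → R (g n) (f (suc n))) →
                    R x (f 0) → ∀ n → Trail R x (alternate f g n) (f n)
  alternate-trail fg gf r zero    = arc r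
  alternate-trail fg gf r (suc n) = r ∷ fg 0 ∷ alternate-trail (fg ∘ suc) (gf ∘ suc) (gf 0) n

  alternate-↭ : ∀ (f g : ℕ → A) n → alternate f g n ↭ applyUpTo f n ++ applyUpTo g n
  alternate-↭ f g zero    = ↭-refl
  alternate-↭ f g (suc n) = ↭-prep (f 0) (↭-trans (↭-prep (g 0) (alternate-↭ (f ∘ suc) (g ∘ suc) n))
    (↭-sym (shift (g 0) (applyUpTo (f ∘ suc) n) (applyUpTo (g ∘ suc) n))))

  applyUpTo-+ : ∀ (f : ℕ → A) m n → applyUpTo f (m + n) ≡ applyUpTo f m ++ applyUpTo (f ∘ (m +_)) n
  applyUpTo-+ f zero    n = refl
  applyUpTo-+ f (suc m) n = cong (f 0 ∷_) (applyUpTo-+ (f ∘ suc) m n)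

  applyDownFrom-↭ : ∀ (f : ℕ → A) n → applyDownFrom f n ↭ applyUpTo f n
  applyDownFrom-↭ f n = ↭-trans (↭-reflexive (sym (reverse-applyUpTo f n))) (↭-reverse (applyUpTo f n))

  -- A closed walk as an infinite sequence: rotations become index shifts, and wrapping around is
  -- rewriting by `period`. `k` need not be the least period.
  record Loop (R : Rel A 0ℓ) (k : ℕ) (c : ℕ → A) : Set where
    field
      period : ∀ n → c (k + n) ≡ c n
      step   : ∀ n → R (c n) (c (suc n))

  Loop-shift : ∀ {R k c} i → Loop R k c → Loop R k (c ∘ (_+ i))
  Loop-shift {k = k} {c} i L = record
    { period = λ n → trans (cong c (+-assoc k n i)) (period (n + i))
    ; step   = λ n → step (n + i)
    }
    where open Loop L

  Loop-period* : ∀ {R k c} → Loop R k c → ∀ q n → c (q * k + n) ≡ c n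
  Loop-period* {k = k} {c} L zero    n = refl
  Loop-period* {k = k} {c} L (suc q) n =
    trans (cong c (+-assoc k (q * k) n)) (trans (Loop.period L (q * k + n)) (Loop-period* L q n))

  applyUpTo-cong : ∀ {f g : ℕ → A} → (∀ n → f n ≡ g n) → ∀ n → applyUpTo f n ≡ applyUpTo g n
  applyUpTo-cong e zero    = refl
  applyUpTo-cong e (suc n) = cong₂ _∷_ (e 0) (applyUpTo-cong (e ∘ suc) n)

  -- Passing from `i` to `suc i` moves `c i` from the front to the back, where it reappears as
  -- `c (suc (k + i))`.
  Loop-rotate : ∀ {R k c} → Loop R (suc k) c → ∀ i → applyUpTo (c ∘ (_+ i)) (suc k) ↭ applyUpTo c (suc k)
  Loop-rotate {k = k} {c} L zero    = ↭-reflexive (applyUpTo-cong (cong c ∘ +-identityʳ) (suc k))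
  Loop-rotate {k = k} {c} L (suc i) = begin
    applyUpTo (c ∘ (_+ suc i)) (suc k)                 ≡⟨ applyUpTo-cong (λ n → cong c (+-suc n i)) (suc k) ⟩
    applyUpTo (c ∘ suc ∘ (_+ i)) (suc k)               ≡⟨ applyUpTo-∷ʳ (c ∘ suc ∘ (_+ i)) k ⟨
    applyUpTo (c ∘ suc ∘ (_+ i)) k ∷ʳ c (suc (k + i))  ↭⟨ ∷↭∷ʳ _ _ ⟨
    c (suc (k + i)) ∷ applyUpTo (c ∘ suc ∘ (_+ i)) k   ≡⟨ cong (_∷ applyUpTo (c ∘ suc ∘ (_+ i)) k) (Loop.period L i) ⟩
    applyUpTo (c ∘ (_+ i)) (suc k)                     ↭⟨ Loop-rotate L i ⟩
    applyUpTo c (suc k)                                ∎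
    where open PermutationReasoning

  Loop-return : ∀ {R k c} → Loop R k c → c k ≡ c 0
  Loop-return {k = k} {c} L = trans (cong c (sym (+-identityʳ k))) (Loop.period L 0)

  suc-period : ∀ {R k c} → Loop R k c → ∀ n → c (suc (k + n)) ≡ c (suc n)
  suc-period {k = k} {c} L n = trans (cong c (sym (+-suc k n))) (Loop.period L (suc n))

  rotate₁ : ∀ {R k c} → Loop R (suc k) c → applyUpTo (c ∘ suc) (suc k) ↭ applyUpTo c (suc k)
  rotate₁ {k = k} {c} L =
    ↭-trans (↭-reflexive (applyUpTo-cong (cong c ∘ +-comm 1) (suc k))) (Loop-rotate L 1)

  module _ (x : A) (xs : List A) where

    -- Reads ys, then x ∷ xs over and over.
    cyclic : List A → ℕ → A
    cyclic []       zero    = x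
    cyclic []       (suc n) = cyclic xs n
    cyclic (y ∷ ys) zero    = y
    cyclic (y ∷ ys) (suc n) = cyclic ys n

    cyclic-drop : ∀ ys n → cyclic ys (length ys + n) ≡ cyclic [] n
    cyclic-drop []       n = refl
    cyclic-drop (y ∷ ys) n = cyclic-drop ys n

    cyclic-take : ∀ ys → applyUpTo (cyclic ys) (length ys) ≡ ys
    cyclic-take []       = refl
    cyclic-take (y ∷ ys) = cong (y ∷_) (cyclic-take ys)

    cyclic-step : ∀ {R} → Trail R x xs x → ∀ {y ys} → Trail R y ys x →
                  ∀ n → R (cyclic (y ∷ ys) n) (cyclic ys n)
    cyclic-step s (arc r) zero          = r
    -- `cyclic [] n` and `cyclic (x ∷ xs) n` agree definitionally only once `n` is split.
    cyclic-step s (arc r) (suc zero)    = cyclic-step s s zero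
    cyclic-step s (arc r) (suc (suc n)) = cyclic-step s s (suc n)
    cyclic-step s (r ∷ t) zero          = r
    cyclic-step s (r ∷ t) (suc n)       = cyclic-step s t n

    unroll : ∀ {R} → Trail R x xs x →
             ∃[ c ] (Loop R (suc (length xs)) c × applyUpTo c (suc (length xs)) ≡ x ∷ xs)
    unroll {R} s = cyclic (x ∷ xs)
             , record { period = λ { zero → cyclic-drop xs 0 ; (suc n) → cyclic-drop xs (suc n) }
                      ; step   = cyclic-step s s }
             , cyclic-take (x ∷ xs)

-- A witness moves down by whole periods to its remainder, so searching one period suffices.
any-periodic? : ∀ {P : ℕ → Set} k → U.Decidable P → (∀ n → P (suc k + n) → P n) → Dec (∃ P)
any-periodic? {P} k P? back = map′
  (λ (n , _ , p) → n , p)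
  (λ (n , p) → n % suc k , m%n<n n (suc k) ,
     back* (n / suc k) (n % suc k) (subst P (trans (m≡m%n+[m/n]*n n (suc k)) (+-comm (n % suc k) _)) p))
  (anyUpTo? P? (suc k))
  where
  back* : ∀ q n → P (q * suc k + n) → P n
  back* zero    n p = p
  back* (suc q) n p = back* q n (back (q * suc k + n) (subst P (+-assoc (suc k) (q * suc k) n) p))

-- Merging closed walks of an extended semicomplete digraph

module Merging (T : Digraph) (semicomplete : Semicomplete T) {A : Set} (φ : A → V T) where
  open Digraph T using (Arc; arc?; no-loop)

  infix 4 _⇢_
  -- Adjacency depends only on parts and `T` has no loops, so elements of one part are never
  -- adjacent: an extended semicomplete digraph.
  _⇢_ : Rel A 0ℓ
  a ⇢ b = Arc (φ a) (φ b)

  Merged : List A → List A → Set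
  Merged xs ys = ∃[ zs ] (Closed _⇢_ zs × zs ↭ xs ++ ys)

  Merged-resp-↭ : ∀ {xs xs′ ys ys′} → xs ↭ xs′ → ys ↭ ys′ → Merged xs ys → Merged xs′ ys′
  Merged-resp-↭ p q (zs , z , r) = zs , z , ↭-trans r (++⁺ p q)

  -- As 2-cycles are allowed, the absence of backward arcs must be recorded too; `hamiltonian-walk`
  -- relies on it.
  Dominates : List A → List A → Set
  Dominates xs ys = ∀ {a b} → a ∈ xs → b ∈ ys → a ⇢ b × ¬ b ⇢ a

  Compared : List A → List A → Set
  Compared xs ys = Merged xs ys ⊎ Dominates xs ys ⊎ Dominates ys xs

  Compared-resp-↭ : ∀ {xs xs′ ys ys′} → xs ↭ xs′ → ys ↭ ys′ → Compared xs ys → Compared xs′ ys′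
  Compared-resp-↭ p q (inj₁ m)        = inj₁ (Merged-resp-↭ p q m)
  Compared-resp-↭ p q (inj₂ (inj₁ d)) = inj₂ (inj₁ λ a∈ b∈ → d (∈-resp-↭ (↭-sym p) a∈) (∈-resp-↭ (↭-sym q) b∈))
  Compared-resp-↭ p q (inj₂ (inj₂ d)) = inj₂ (inj₂ λ b∈ a∈ → d (∈-resp-↭ (↭-sym q) b∈) (∈-resp-↭ (↭-sym p) a∈))

  -- Go round `c` from c₁ to cₖ₊₁ = c₀, cross to b₀ = bₗ₊₁, run down to b₁ and cross back to c₁.
  -- Since `b` is reversed, the crossings sit at (0, 0) and (1, 1) and no index has to decrease.
  splice : ∀ {c b k l} → Loop _⇢_ (suc k) c → Loop (flip _⇢_) (suc l) b →
           c 0 ⇢ b 0 → b 1 ⇢ c 1 → Merged (applyUpTo c (suc k)) (applyUpTo b (suc l))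
  splice {c} {b} {k} {l} C B r s =
    applyUpTo (c ∘ suc) (suc k) ++ applyDownFrom (b ∘ suc) (suc l) ++ [] ,
    closed (ascend (C.step ∘ suc) k
             (subst₂ _⇢_ (sym (Loop-return C)) (sym (Loop-return B)) r
               ∷ descend (B.step ∘ suc) l (arc s))) ,
    ++⁺ (rotate₁ C) (begin
      applyDownFrom (b ∘ suc) (suc l) ++ []  ≡⟨ ++-identityʳ _ ⟩
      applyDownFrom (b ∘ suc) (suc l)        ↭⟨ applyDownFrom-↭ (b ∘ suc) (suc l) ⟩
      applyUpTo (b ∘ suc) (suc l)            ↭⟨ rotate₁ B ⟩
      applyUpTo b (suc l)                    ∎)
    where
    module C = Loop C
    module B = Loop B
    open PermutationReasoning

  -- c₀ bₗ₊₁ bₗ … bₖ₊₁ c₁ b₁ c₂ b₂ … cₖ bₖ, where l = k + e.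
  weave : ∀ {c b k e} → Loop _⇢_ (suc k) c → Loop (flip _⇢_) (suc (k + e)) b →
          (∀ n → c n ⇢ b n) → (∀ n → b n ⇢ c (suc n)) →
          Merged (applyUpTo c (suc k)) (applyUpTo b (suc (k + e)))
  weave {c} {b} {k} {e} C B cb bc =
    c 0 ∷ applyDownFrom b₊ (suc e) ++ alternate (c ∘ suc) (b ∘ suc) k ,
    closed (subst (c 0 ⇢_) (sym (Loop-return B)) (cb 0)
             ∷ descend (λ n → subst (λ m → b (suc m) ⇢ b₊ n) (sym (+-suc k n)) (B.step (suc k + n))) e
                 (subst (Trail _⇢_ _ _) (Loop-return C)
                   (alternate-trail (cb ∘ suc) (bc ∘ suc) bₖ₊₁⇢c₁ k))) ,
    ↭-prep (c 0) (begin
      applyDownFrom b₊ (suc e) ++ alternate (c ∘ suc) (b ∘ suc) k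
        ↭⟨ ++⁺ (applyDownFrom-↭ b₊ (suc e)) (alternate-↭ (c ∘ suc) (b ∘ suc) k) ⟩
      applyUpTo b₊ (suc e) ++ applyUpTo (c ∘ suc) k ++ applyUpTo (b ∘ suc) k
        ↭⟨ shifts (applyUpTo b₊ (suc e)) (applyUpTo (c ∘ suc) k) ⟩
      applyUpTo (c ∘ suc) k ++ applyUpTo b₊ (suc e) ++ applyUpTo (b ∘ suc) k
        ↭⟨ ++⁺ˡ (applyUpTo (c ∘ suc) k) (++-comm (applyUpTo b₊ (suc e)) (applyUpTo (b ∘ suc) k)) ⟩
      applyUpTo (c ∘ suc) k ++ applyUpTo (b ∘ suc) k ++ applyUpTo b₊ (suc e)
        ≡⟨ cong (applyUpTo (c ∘ suc) k ++_) (applyUpTo-+ (b ∘ suc) k (suc e)) ⟨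
      applyUpTo (c ∘ suc) k ++ applyUpTo (b ∘ suc) (k + suc e)
        ≡⟨ cong (λ m → applyUpTo (c ∘ suc) k ++ applyUpTo (b ∘ suc) m) (+-suc k e) ⟩
      applyUpTo (c ∘ suc) k ++ applyUpTo (b ∘ suc) (suc (k + e))
        ↭⟨ ++⁺ˡ (applyUpTo (c ∘ suc) k) (rotate₁ B) ⟩
      applyUpTo (c ∘ suc) k ++ applyUpTo b (suc (k + e)) ∎)
    where
    module B = Loop B
    open PermutationReasoning
    b₊ : ℕ → A
    b₊ = b ∘ (suc k +_)
    bₖ₊₁⇢c₁ : b₊ 0 ⇢ c 1
    bₖ₊₁⇢c₁ = subst (b₊ 0 ⇢_) (suc-period C 0) (bc (suc k + 0))

  -- In the grid of the pairs (i , j), an arc c i ⇢ b j whose diagonal successor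
  -- is joined the other way allows a splice. Otherwise the orientation is
  -- constant along the diagonals, so two adjacent diagonals of opposite
  -- orientation allow the two walks to be woven together.
  module _ {c b k e} (C : Loop _⇢_ (suc k) c) (B : Loop (flip _⇢_) (suc (k + e)) b) where
    private
      l = k + e
      module C = Loop C
      module B = Loop B
      cs = applyUpTo c (suc k)
      bs = applyUpTo b (suc l)
      R S : ℕ → ℕ → Set
      R i j = c i ⇢ b j
      S i j = b j ⇢ c i

    -- A condition on two consecutive terms of each walk is periodic in both indices, so its search
    -- over the grid is finite.
    any₂? : {P : V T → V T → V T → V T → Set} → (∀ w x y z → Dec (P w x y z)) →
            Dec (∃₂ λ i j → P (φ (c i)) (φ (c (suc i))) (φ (b j)) (φ (b (suc j))))
    any₂? {P} P? = any-periodic? k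
      (λ i → any-periodic? l (λ j → P? _ _ _ _)
               (λ j → subst₂ (P _ _) (cong φ (B.period j)) (cong φ (suc-period B j))))
      (λ i (j , p) → j ,
         subst₂ (λ x y → P x y (φ (b j)) (φ (b (suc j)))) (cong φ (C.period i)) (cong φ (suc-period C i)) p)

    module _ (unsplicable : ∀ i j → R i j → S (suc i) (suc j) → ⊥) where

      -- If the parts agreed, `c i` could use the arc leaving `b j` and `b j` the arc leaving `c i`,
      -- which is a splice.
      apart : ∀ i j → φ (c i) ≢ φ (b j)
      -- Adding `l` acts as subtracting 1, the period being `suc l`; the original walk goes from
      -- `b j` to `b (l + j)`.
      apart i j eq = unsplicable i (l + j)
        (subst (λ u → Arc u (φ (b (l + j)))) (trans (cong φ (B.period j)) (sym eq)) (B.step (l + j)))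
        (subst (λ u → Arc u (φ (c (suc i)))) (trans eq (cong φ (sym (B.period j)))) (C.step i))

      total : ∀ i j → R i j ⊎ S i j
      total i j = semicomplete _ _ (apart i j)

      diagonal : ∀ {i j} n → R i j → R (n + i) (n + j)
      diagonal zero    r = r
      diagonal {i} {j} (suc n) r with total (suc n + i) (suc n + j)
      ... | inj₁ r′ = r′
      ... | inj₂ s  = ⊥-elim (unsplicable _ _ (diagonal n r) s)

      -- 1 + m is a common multiple of both periods.
      m : ℕ
      m = l + k * suc l

      c-wraps : ∀ i → c (suc m + i) ≡ c i
      c-wraps i = trans (cong (λ n → c (n + i)) (*-comm (suc k) (suc l))) (Loop-period* C (suc l) i)

      b-wraps : ∀ j → b (suc m + j) ≡ b j
      b-wraps j = Loop-period* B (suc k) j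

      -- `R` travels `m` diagonal steps to the cell just before the next copy of `(i , j)`; an `S`
      -- at that copy would be a splice.
      exclusive : ∀ {i j} → R i j → ¬ S i j
      exclusive {i} {j} r s = unsplicable (m + i) (m + j) (diagonal m r)
        (subst₂ _⇢_ (sym (b-wraps j)) (sym (c-wraps i)) s)

      -- One step back along the diagonal amounts to `m` steps forward.
      undiagonal : ∀ {i j} → R (suc i) (suc j) → R i j
      undiagonal {i} {j} r = subst₂ _⇢_ (c-wraps i) (b-wraps j)
        (subst₂ R (+-suc m i) (+-suc m j) (diagonal m r))

      diagonalS : ∀ {i j} n → S i j → S (n + i) (n + j)
      diagonalS zero s = s
      diagonalS {i} {j} (suc n) s with total (suc n + i) (suc n + j)
      ... | inj₁ r  = ⊥-elim (exclusive (undiagonal r) (diagonalS n s))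
      ... | inj₂ s′ = s′

      -- With `(i , j)` moved to the origin, `R` fills the main diagonal and `S` the adjacent one,
      -- as `weave` requires.
      woven : ∀ i j → R i j → S (suc i) j → Merged cs bs
      woven i j r s = Merged-resp-↭ (Loop-rotate C i) (Loop-rotate B j)
        (weave (Loop-shift i C) (Loop-shift j B) (λ n → diagonal n r)
               (λ n → subst (λ i → S i (n + j)) (+-suc n i) (diagonalS n s)))

      module _ (unwoven : ∀ i j → R i j → S (suc i) j → ⊥) where

        across : ∀ {i j} n → R i j → R (n + i) j
        across zero r = r
        across {i} {j} (suc n) r with total (suc n + i) j
        ... | inj₁ r′ = r′
        ... | inj₂ s  = ⊥-elim (unwoven (n + i) j (across n r) s)

        -- A diagonal step and `k` steps across advance the first index by the full period `suc k`,
        -- leaving only the change in the second.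
        up : ∀ {i j} → R i j → R i (suc j)
        up {i} {j} r = subst (_⇢ b (suc j)) (C.period i)
          (subst (λ i → R i (suc j)) (+-suc k i) (across k (diagonal 1 r)))

        up* : ∀ {i j} n → R i j → R i (n + j)
        up* zero    r = r
        up* (suc n) r = up (up* n r)

        origin : ∀ {i j} → R i j → R 0 0
        -- Adding `i * k` to `i` gives `i * suc k`, a multiple of the period; likewise `j * l` for
        -- `j`.
        origin {i} {j} r = subst₂ _⇢_ (wrap C i) (wrap B j) (across (i * k) (up* (j * l) r))
          where
          wrap : ∀ {R k c} → Loop R (suc k) c → ∀ i → c (i * k + i) ≡ c 0
          wrap {k = k} {c} L i = trans (cong c eq) (Loop-period* L i 0)
            where
            eq : i * k + i ≡ i * suc k + 0
            eq = trans (+-comm (i * k) i) (trans (sym (*-suc i k)) (sym (+-identityʳ _)))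

        -- `origin` carries any `R` to the cell (0, 0), and `across` and `up*` spread it from there,
        -- so this one cell decides the whole grid.
        one-way : Dominates cs bs ⊎ Dominates bs cs
        one-way with arc? (φ (c 0)) (φ (b 0))
        ... | yes r₀ = inj₁ λ x∈ y∈ → onto (∈-applyUpTo⁻ c x∈) (∈-applyUpTo⁻ b y∈)
          where
          onto : ∀ {x y} → (∃ λ i → i < suc k × x ≡ c i) → (∃ λ j → j < suc l × y ≡ b j) → x ⇢ y × ¬ y ⇢ x
          onto (i , _ , refl) (j , _ , refl) = r , exclusive r
            where r = subst₂ R (+-identityʳ i) (+-identityʳ j) (across i (up* j r₀))
        ... | no ¬r₀ = inj₂ λ y∈ x∈ → onto (∈-applyUpTo⁻ c x∈) (∈-applyUpTo⁻ b y∈)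
          where
          onto : ∀ {x y} → (∃ λ i → i < suc k × x ≡ c i) → (∃ λ j → j < suc l × y ≡ b j) → y ⇢ x × ¬ x ⇢ y
          onto (i , _ , refl) (j , _ , refl) with total i j
          ... | inj₁ r = contradiction (origin r) ¬r₀
          ... | inj₂ s = s , λ r → ¬r₀ (origin r)

    merge-loops : Compared cs bs
    merge-loops with any₂? (λ w x y z → arc? w y ×-dec arc? z x)
    ... | yes (i , j , r , s) = inj₁ (Merged-resp-↭ (Loop-rotate C i) (Loop-rotate B j)
                                        (splice (Loop-shift i C) (Loop-shift j B) r s))
    ... | no ¬splice with any₂? (λ w x y z → arc? w y ×-dec arc? y x)
    ...   | yes (i , j , r , s) = inj₁ (woven (λ i j r s → ¬splice (i , j , r , s)) i j r s)
    ...   | no ¬weave = inj₂ (one-way (λ i j r s → ¬splice (i , j , r , s)) (λ i j r s → ¬weave (i , j , r , s)))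

  -- The shorter walk plays `c`, which supplies the surplus `e` of `weave`; the other is reversed to
  -- become `b`.
  merge-≤ : ∀ {x xs y ys} → length xs ≤ length ys → Trail _⇢_ x xs x → Trail _⇢_ y ys y →
            Compared (x ∷ xs) (y ∷ ys)
  merge-≤ {x} {xs} {y} {ys} le s t
    with e , eq ← m≤n⇒∃[o]m+o≡n le
       | c , C , takeC ← unroll x xs s
       | b , B , takeB ← unroll y (reverse ys) (Trail-reverse t)
    = Compared-resp-↭ C↭ B↭ (merge-loops C (subst (λ l → Loop (flip _⇢_) (suc l) b) (sym l≡k+e) B))
    where
    l≡k+e : length xs + e ≡ length (reverse ys)
    l≡k+e = trans eq (sym (length-reverse ys))

    C↭ : applyUpTo c (suc (length xs)) ↭ x ∷ xs
    C↭ = ↭-reflexive takeC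

    B↭ : applyUpTo b (suc (length xs + e)) ↭ y ∷ ys
    B↭ = ↭-trans (↭-reflexive (trans (cong (applyUpTo b ∘ suc) l≡k+e) takeB)) (↭-prep y (↭-reverse ys))

  merge : ∀ {xs ys} → Closed _⇢_ xs → Closed _⇢_ ys → Compared xs ys
  merge (closed {x} {xs} s) (closed {y} {ys} t) with ≤-total (length xs) (length ys)
  ... | inj₁ le = merge-≤ le s t
  ... | inj₂ ge with merge-≤ ge t s
  ...   | inj₁ (zs , z , p)  = inj₁ (zs , z , ↭-trans p (++-comm (y ∷ ys) (x ∷ xs)))
  ...   | inj₂ (inj₁ d)      = inj₂ (inj₂ d)
  ...   | inj₂ (inj₂ d)      = inj₂ (inj₁ d)

  -- Each walk is opened at its closing arc and its last vertex sent to the first vertex of the next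
  -- walk.
  merge-triangle : ∀ {xs ys zs} → Closed _⇢_ xs → Closed _⇢_ ys → Closed _⇢_ zs →
                   Dominates xs ys → Dominates ys zs → Dominates zs xs → Closed _⇢_ (xs ++ ys ++ zs)
  merge-triangle (closed s) (closed t) (closed u) xy yz zx = closed
    (Trail-++ (Trail-redirect s (λ a∈ → proj₁ (xy a∈ (here refl))))
      (Trail-++ (Trail-redirect t (λ a∈ → proj₁ (yz a∈ (here refl))))
        (Trail-redirect u (λ a∈ → proj₁ (zx a∈ (here refl))))))

  -- Chains of closed walks ordered by domination

  record Chain (xs : List A) : Set where
    constructor mkChain
    field
      walks      : List (List A)
      all-closed : All (Closed _⇢_) walks
      ordered    : AllPairs Dominates walks
      content    : concat walks ↭ xs

  -- Finds the first walk `x` that `v` does not dominate. Being a sublist, `rest` inherits the chain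
  -- order; its length bound serves the recursion of `insert`.
  scan : ∀ {v ws} → Closed _⇢_ v → All (Closed _⇢_) ws →
         All (Dominates v) ws ⊎
         ∃₂ λ x rest → rest ⊆ ws × x ∈ ws × length rest < length ws ×
                       concat ws ↭ x ++ concat rest × Closed _⇢_ x × (Merged v x ⊎ Dominates x v)
  scan v [] = inj₁ []
  scan {ws = w ∷ ws} v (c ∷ cs) with merge v c
  ... | inj₁ m        = inj₂ (w , ws , skip w ⊆-refl , here refl , ≤-refl , ↭-refl , c , inj₁ m)
  ... | inj₂ (inj₂ d) = inj₂ (w , ws , skip w ⊆-refl , here refl , ≤-refl , ↭-refl , c , inj₂ d)
  ... | inj₂ (inj₁ d) with scan v cs
  ...   | inj₁ ds = inj₁ ((λ {a} → d {a}) ∷ ds)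
  ...   | inj₂ (x , rest , sub , x∈ , lt , p , cx , r) =
    inj₂ (x , w ∷ rest , refl ∷ sub , there x∈ , s≤s lt ,
          ↭-trans (++⁺ˡ w p) (shifts w x) , cx , r)

  dominates-all : ∀ {x xs ys} → All (Dominates x) xs → concat ys ↭ concat xs → All (Dominates x) ys
  dominates-all {x} {xs} ds p = All.tabulate λ y∈ {a} {b} a∈ b∈ →
    let z , b∈z , z∈ = ∈-concat⁻′ xs (∈-resp-↭ p (∈-concat⁺′ b∈ y∈)) in All.lookup ds z∈ a∈ b∈z

  -- The recursion is on the bound `n`, since `rest` is no structural subterm. A `v` dominating the
  -- first walk may fail to dominate a later one, so it cannot simply be put in front.
  insert : ∀ n {v ws} → length ws ≤ n → Closed _⇢_ v → All (Closed _⇢_) ws → AllPairs Dominates ws →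
           Chain (v ++ concat ws)
  insert n {v} _ c [] [] = mkChain (v ∷ []) (c ∷ []) ([] ∷ []) ↭-refl
  insert (suc n) {v} {w ∷ ws} (s≤s le) c (d ∷ ds) (wd ∷ o) with merge c d
  ... | inj₁ (z , cz , p) with mkChain us cu ou pu ← insert n le cz ds o =
    mkChain us cu ou (↭-trans pu (↭-trans (++⁺ʳ (concat ws) p) (↭-reflexive (++-assoc v w (concat ws)))))
  -- The recursive result has the vertices of `v` and `ws`, all dominated by `w`, so `w` stays in
  -- front.
  ... | inj₂ (inj₂ w⇒v) with mkChain us cu ou pu ← insert n le c ds o =
    mkChain (w ∷ us) (d ∷ cu) (dominates-all {xs = v ∷ ws} ((λ {a} → w⇒v {a}) ∷ wd) pu ∷ ou)
            (↭-trans (++⁺ˡ w pu) (shifts w v))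
  ... | inj₂ (inj₁ v⇒w) with scan c ds
  ...   | inj₁ v⇒ws = mkChain (v ∷ w ∷ ws) (c ∷ d ∷ ds) (((λ {a} → v⇒w {a}) ∷ v⇒ws) ∷ wd ∷ o) ↭-refl
  ...   | inj₂ (x , rest , sub , x∈ , lt , p , cx , inj₁ (z , cz , q))
          with mkChain us cu ou pu ← insert n {ws = w ∷ rest} (≤-trans lt le) cz (d ∷ All-resp-⊆ sub ds)
                                       (AllPairs-resp-⊆ (refl ∷ sub) (wd ∷ o)) =
    mkChain us cu ou (begin
      concat us                    ↭⟨ pu ⟩
      z ++ w ++ concat rest        ↭⟨ ++⁺ʳ (w ++ concat rest) q ⟩
      (v ++ x) ++ w ++ concat rest ≡⟨ ++-assoc v x (w ++ concat rest) ⟩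
      v ++ x ++ w ++ concat rest   ↭⟨ ++⁺ˡ v (shifts x w) ⟩
      v ++ w ++ x ++ concat rest   ↭⟨ ++⁺ˡ v (++⁺ˡ w p) ⟨
      v ++ w ++ concat ws          ∎)
    where open PermutationReasoning
  -- The triangle is closed by `w` dominating `x`, which is part of the chain order.
  ...   | inj₂ (x , rest , sub , x∈ , lt , p , cx , inj₂ x⇒v)
          with mkChain us cu ou pu ← insert n {ws = rest} (<⇒≤ (≤-trans lt le))
                                       (merge-triangle c d cx v⇒w (All.lookup wd x∈) x⇒v)
                                       (All-resp-⊆ sub ds) (AllPairs-resp-⊆ sub o) =
    mkChain us cu ou (begin
      concat us                      ↭⟨ pu ⟩
      (v ++ w ++ x) ++ concat rest   ≡⟨ ++-assoc v (w ++ x) (concat rest) ⟩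
      v ++ (w ++ x) ++ concat rest   ≡⟨ cong (v ++_) (++-assoc w x (concat rest)) ⟩
      v ++ w ++ x ++ concat rest     ↭⟨ ++⁺ˡ v (++⁺ˡ w p) ⟨
      v ++ w ++ concat ws            ∎)
    where open PermutationReasoning

  chain : ∀ {ws} → All (Closed _⇢_) ws → Chain (concat ws)
  chain [] = mkChain [] [] [] ↭-refl
  chain {w ∷ ws} (c ∷ cs) with mkChain us cu ou pu ← chain cs
    with mkChain us′ cu′ ou′ pu′ ← insert (length us) ≤-refl c cu ou =
    mkChain us′ cu′ ou′ (↭-trans pu′ (++⁺ˡ w pu))

  -- All but the first walk of a chain span a set that no arc leaves.
  hamiltonian-walk : (∀ {P : V T → Set} → (∀ {u w} → P u → Arc u w → P w) → ∀ {u} → P u → ∀ w → P w) →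
                     V T → ∀ {ws} → All (Closed _⇢_) ws → (∀ u → ∃[ a ] (a ∈ concat ws × φ a ≡ u)) →
                     ∃[ w ] (Closed _⇢_ w × w ↭ concat ws)
  hamiltonian-walk strong u₀ {ws} cs cover with chain cs
  ... | mkChain [] _ _ p with a , a∈ , _ ← cover u₀ with () ← ∈-resp-↭ (↭-sym p) a∈
  ... | mkChain (w ∷ []) (c ∷ []) _ p = w , c , ↭-trans (↭-reflexive (sym (++-identityʳ w))) p
  ... | mkChain (_ ∷ _ ∷ us) (closed {x} {xs} _ ∷ closed {y} {ys} _ ∷ _) (dom ∷ _) p =
    absurd (strong outgoing (y , here refl , refl) (φ x))
    where
    vs = (y ∷ ys) ∷ us
    P : V T → Set
    P u = ∃[ a ] (a ∈ concat vs × φ a ≡ u)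
    dominated : ∀ {a b} → a ∈ x ∷ xs → b ∈ concat vs → a ⇢ b × ¬ b ⇢ a
    dominated a∈ b∈ = let z , b∈z , z∈ = ∈-concat⁻′ vs b∈ in All.lookup dom z∈ a∈ b∈z
    outgoing : ∀ {u w} → P u → Arc u w → P w
    outgoing {w = w} (a , a∈ , refl) aw with b , b∈ , refl ← cover w
      with ∈-++⁻ (x ∷ xs) (∈-resp-↭ (↭-sym p) b∈)
    ... | inj₁ b∈x = contradiction aw (proj₂ (dominated b∈x a∈))
    ... | inj₂ b∈v = b , b∈v , refl
    -- A vertex of a later walk in the part of `x` would be dominated by `x`, giving a loop of `T`.
    absurd : ∀ {B : Set} → P (φ x) → B
    absurd (a , a∈ , eq) = contradiction (subst (Arc (φ x)) eq (proj₁ (dominated (here refl) a∈))) (no-loop _)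

-- Segments and cycles

-- Distinctness is tracked on the concatenation instead, which `split-segments` leaves unchanged.
data Segment {A : Set} (R : Rel A 0ℓ) : List A → Set where
  segment : ∀ {x xs} → Linked R (x ∷ xs) → Segment R (x ∷ xs)

module _ {A : Set} {R : Rel A 0ℓ} where

  -- While more segments are wanted, first vertices are cut off one by one; the bound by
  -- `length (concat ps)` ensures that enough vertices exist.
  split-segments : ∀ ps m → All (Segment R) ps → length ps ≤ m → m ≤ length (concat ps) →
                   ∃[ qs ] (All (Segment R) qs × length qs ≡ m × concat qs ≡ concat ps)
  split-segments [] zero [] _ _ = [] , [] , refl , refl
  split-segments ((x ∷ []) ∷ ps) (suc m) (s ∷ ss) (s≤s le) (s≤s ge)
    with qs , ts , eq , con ← split-segments ps m ss le ge =
    (x ∷ []) ∷ qs , s ∷ ts , cong suc eq , cong (x ∷_) con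
  split-segments ((x ∷ y ∷ p) ∷ ps) (suc m) (segment (r ∷ rs) ∷ ss) (s≤s le) (s≤s ge)
    with suc (length ps) ≤? m
  ... | yes le′ with qs , ts , eq , con ← split-segments ((y ∷ p) ∷ ps) m (segment rs ∷ ss) le′ ge =
    (x ∷ []) ∷ qs , segment [-] ∷ ts , cong suc eq , cong (x ∷_) con
  -- The failed test and `le` force `length ps ≡ m`, so the count is already right.
  ... | no ¬le′ = (x ∷ y ∷ p) ∷ ps , segment (r ∷ rs) ∷ ss , cong suc (≤-antisym le (≤-pred (≰⇒> ¬le′))) , refl

  Trail⇒Linked : ∀ {x xs y} → Trail R x xs y → Linked R (x ∷ xs ∷ʳ y)
  Trail⇒Linked (arc r)       = r ∷ [-]
  Trail⇒Linked (r ∷ t)       = r ∷ Trail⇒Linked t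

  Linked⇒Trail : ∀ {x} xs {y} → Linked R (x ∷ xs ∷ʳ y) → Trail R x xs y
  Linked⇒Trail []       (r ∷ _) = arc r
  Linked⇒Trail (z ∷ zs) (r ∷ l) = r ∷ Linked⇒Trail zs l

  Trail-split : ∀ {x} xs {z zs y} → Trail R x (xs ++ z ∷ zs) y → Trail R x xs z × Trail R z zs y
  Trail-split []       (r ∷ t) = arc r , t
  Trail-split (_ ∷ xs) (r ∷ t) = let s , s′ = Trail-split xs t in r ∷ s , s′

  Trail-map : ∀ {B : Set} {S : Rel B 0ℓ} (f : A → B) → (∀ {a b} → R a b → S (f a) (f b)) →
              ∀ {x xs y} → Trail R x xs y → Trail S (f x) (map f xs) (f y)
  Trail-map f g (arc r) = arc (g r)
  Trail-map f g (r ∷ t) = g r ∷ Trail-map f g t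

  extend : ∀ {x xs ys y} → Linked R (x ∷ xs) → (∀ {z} → z ∈ x ∷ xs → Trail R z ys y) → Trail R x (xs ++ ys) y
  extend [-]     f = f (here refl)
  extend (r ∷ l) f = r ∷ extend l (f ∘ there)

module _ {A B : Set} {R : Rel A 0ℓ} {S : Rel B 0ℓ} (seg : A → List B)
         (between-segs : ∀ {a a′ b b′} → R a a′ → b ∈ seg a → b′ ∈ seg a′ → S b b′) where

  -- An arc of `R` joins every vertex of one segment to every vertex of the next, so end vertices
  -- need no care and any `e` in the final segment will do.
  expand-trail : ∀ {a as z b bs e} → seg a ≡ b ∷ bs → Linked S (b ∷ bs) → e ∈ seg z → Trail R a as z →
                 All (Segment S ∘ seg) as → Trail S b (bs ++ concatMap seg as) e
  expand-trail eq l e∈ (arc r) [] = extend l λ x∈ → arc (between-segs r (subst (_ ∈_) (sym eq) x∈) e∈)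
  expand-trail eq l e∈ (_∷_ {z = a′} r t) (s ∷ ss) with seg a′ in eq′ | s
  ... | b′ ∷ bs′ | segment l′ = extend l λ x∈ →
    between-segs r (subst (_ ∈_) (sym eq) x∈) (subst (b′ ∈_) (sym eq′) (here refl)) ∷ expand-trail eq′ l′ e∈ t ss

  expand-closed : ∀ {as} → Closed R as → All (Segment S ∘ seg) as → Closed S (concatMap seg as)
  expand-closed (closed {a} t) (s ∷ ss) with seg a in eq | s
  ... | b ∷ bs | segment l = closed (expand-trail eq l (subst (b ∈_) (sym eq) (here refl)) t ss)

closed⇒cycle : ∀ D {c} → Closed (Digraph.Arc D) c → Unique c → IsCycle D c
closed⇒cycle D (closed (arc r))   u = contradiction r (Digraph.no-loop D _)
closed⇒cycle D (closed t@(_ ∷ _)) u = mkCycle (s≤s (s≤s z≤n)) u (Trail⇒Linked t)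

cycle⇒closed : ∀ D {c} → IsCycle D c → Closed (Digraph.Arc D) c
cycle⇒closed D (mkCycle {xs = xs} _ _ l) = closed (Linked⇒Trail xs l)

cycle⇒unique : ∀ D {c} → IsCycle D c → Unique c
cycle⇒unique D (mkCycle _ u _) = u

length-vertices : ∀ D → length (Digraph.vertices D) ≡ order D
length-vertices D = trans (length-map (Inverse.from (Digraph.enum D)) (allFin (order D))) (length-tabulate id)

-- The two implications

another : ∀ {n} {A : Set} → A ↔ Fin n → 2 ≤ n → (a : A) → ∃ λ (b : A) → b ≢ a
another {n} {A} e (s≤s (s≤s _)) a = choose (to a) refl
  where
  open Inverse e using (to; from; strictlyInverseˡ)
  choose : ∀ i → to a ≡ i → ∃ λ (b : A) → b ≢ a
  choose Fin.zero    eq = from (Fin.suc Fin.zero) , λ b≡a →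
    contradiction (trans (sym (strictlyInverseˡ (Fin.suc Fin.zero))) (trans (cong to b≡a) eq)) λ ()
  choose (Fin.suc i) eq = from Fin.zero , λ b≡a →
    contradiction (trans (sym (strictlyInverseˡ Fin.zero)) (trans (cong to b≡a) eq)) λ ()

a-vertex : ∀ D → 1 ≤ order D → V D
a-vertex D = pick (Digraph.enum D)
  where
  pick : ∀ {n} {A : Set} → A ↔ Fin n → 1 ≤ n → A
  pick e (s≤s _) = Inverse.from e Fin.zero

nonempty-list : ∀ {A : Set} {xs : List A} → 1 ≤ length xs → ∃[ x ] (x ∈ xs)
nonempty-list {xs = x ∷ xs} _ = x , here refl

pc-minimal : ∀ D {ps} → IsPathCover D ps → pc D ≤ length ps
pc-minimal D {ps} cover = proj₂ (pc-isSmallest D) (length ps) (ps , refl , cover)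

pc-positive : ∀ D → 1 ≤ order D → 1 ≤ pc D
pc-positive D pos = positive (proj₁ (pc-isSmallest D))
  where
  positive : ∀ {k} → PathCoverable D k → 1 ≤ k
  positive (_ , refl , cover) with IsPathCover.covers cover (a-vertex D pos)
  ... | here _  = s≤s z≤n
  ... | there _ = s≤s z≤n

module _ (T : Digraph) (H : V T → Digraph) where
  private
    module T = Digraph T
    module H u = Digraph (H u)
    Q  = T ⟦ H ⟧
    Q′ = T ⟦ K̄ ∘ order ∘ H ⟧

  -- A path of `Q` projects to `T`, arcs within an `H u` leaving the part unchanged. This extracts
  -- the strength of `T` as an invariance principle.
  strong-invariant : (∀ u → 1 ≤ order (H u)) → Strong Q → {P : V T → Set} →
                     (∀ {u w} → P u → T.Arc u w → P w) → ∀ {u} → P u → ∀ w → P w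
  strong-invariant inhabited strong {P} invariant {u} pu w
    with _ , path , first , final ← strong (u , a-vertex (H u) (inhabited u)) (w , a-vertex (H w) (inhabited w))
    = follow (IsPath.arcs path) first final pu
    where
    follow : ∀ {p x y} → Linked (CompositionArc T H) p → head p ≡ just x → last p ≡ just y →
             P (proj₁ x) → P (proj₁ y)
    follow [-]               refl refl px = px
    follow (within _ ∷ l)    refl eq   px = follow l refl eq px
    follow (between uw ∷ l)  refl eq   px = follow l refl eq (invariant px uw)

  -- From a Hamiltonian cycle to a cycle subdigraph

  module Forward (two : 2 ≤ order T) where

    Group : Set
    Group = Σ (V T) λ u → V (H u) × List (V (H u))

    -- A run is represented by its first vertex, so the contracted cycle is a sublist of the
    -- Hamiltonian one and inherits distinctness.
    start : Group → V Q
    start (u , h , _) = u , h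

    path : ∀ {u} → V (H u) × List (V (H u)) → List (V (H u))
    path (h , hs) = h ∷ hs

    seg : Group → List (V Q)
    seg (u , p) = map (u ,_) (path p)

    -- z ∷ ys cut into its maximal runs inside the H u.
    record Grouping (z : V Q) (ys : List (V Q)) (w : V Q) : Set where
      constructor mkGrouping
      field
        run        : List (V (H (proj₁ z)))
        groups     : List Group
        content    : map (proj₁ z ,_) run ++ concatMap seg groups ≡ ys
        linked     : Linked (H.Arc (proj₁ z)) (proj₂ z ∷ run)
        all-linked : All (λ (u , p) → Linked (H.Arc u) (path p)) groups
        trail      : Trail (λ x y → T.Arc (proj₁ x) (proj₁ y)) z (map start groups) w
        starts     : map start groups ⊆ ys

    endpoint : V Q → List (V Q) → V Q
    endpoint z []       = z
    endpoint z (y ∷ ys) = endpoint y ys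

    endpoint-++ : ∀ z ys {x xs} → endpoint z (ys ++ x ∷ xs) ≡ endpoint x xs
    endpoint-++ z []       = refl
    endpoint-++ z (y ∷ ys) = endpoint-++ y ys

    endpoint-part : ∀ {u x xs} → proj₁ x ≡ u → All (λ y → proj₁ y ≡ u) xs → proj₁ (endpoint x xs) ≡ u
    endpoint-part eq []        = eq
    endpoint-part _  (eq ∷ eqs) = endpoint-part eq eqs

    -- The inequality makes the closing arc change parts, so the last run does not continue into
    -- `w`.
    group : ∀ {z ys w} → Trail (CompositionArc T H) z ys w → proj₁ (endpoint z ys) ≢ proj₁ w → Grouping z ys w
    group (arc (within _))   ne = contradiction refl ne
    group (arc (between uw)) ne = mkGrouping [] [] refl [-] [] (arc uw) []
    group (_∷_ {z = y} a t) ne with group t ne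
    group (_∷_ {z = _ , h} (within a) t) ne | mkGrouping run gs eq l ls tr sub =
      mkGrouping (h ∷ run) gs (cong (_ ∷_) eq) (a ∷ l) ls (same-part tr) (skip _ sub)
      where
      -- The first arc depends only on the part, so the start can move back to the preceding vertex
      -- of the run.
      same-part : ∀ {u h h′ xs w} → Trail (λ x y → T.Arc (proj₁ x) (proj₁ y)) (u , h) xs w →
                  Trail (λ x y → T.Arc (proj₁ x) (proj₁ y)) (u , h′) xs w
      same-part (arc r) = arc r
      same-part (r ∷ t) = r ∷ t
    group (_∷_ {z = u , h} (between uw) t) ne | mkGrouping run gs eq l ls tr sub =
      mkGrouping [] ((u , h , run) ∷ gs) (cong (_ ∷_) eq) [-] (l ∷ ls) (uw ∷ tr) (refl ∷ sub)

    first-outside : ∀ u {v : V Q} xs → v ∈ xs → proj₁ v ≢ u →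
                    ∃[ as ] ∃₂ λ z bs → (xs ≡ as ++ z ∷ bs × All (λ a → proj₁ a ≡ u) as × proj₁ z ≢ u)
    first-outside u (x ∷ xs) v∈ ne with proj₁ x T.≟ u
    ... | no x≢u = [] , x , xs , refl , [] , x≢u
    first-outside u (x ∷ xs) (here refl) ne | yes eq = contradiction eq ne
    first-outside u (x ∷ xs) (there v∈)  ne | yes eq
      with as , z , bs , refl , all-u , z≢u ← first-outside u xs v∈ ne =
      x ∷ as , z , bs , refl , eq ∷ all-u , z≢u

    relabel : V Q → V Q′
    relabel (u , h) = u , Inverse.to (H.enum u) h

    relabel-injective : ∀ {x y} → relabel x ≡ relabel y → x ≡ y
    relabel-injective {u , h} {u′ , h′} eq with refl ← cong proj₁ eq =
      cong (u ,_) (Injection.injective (↔⇒↣ (H.enum u)) (same-part eq))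
      where
      same-part : ∀ {a b : Fin (order (H u))} → _≡_ {A = V Q′} (u , a) (u , b) → a ≡ b
      same-part refl = refl

    module _ (gs : List Group) (distinct : Unique (concatMap seg gs)) (covers : ∀ v → v ∈ concatMap seg gs)
             (linked : All (λ (u , p) → Linked (H.Arc u) (path p)) gs)
             (starts : Unique (map start gs)) (u : V T) where
      open Fiber T._≟_ {λ u → V (H u) × List (V (H u))} u

      cover : List (List (V (H u)))
      cover = map path (fiber gs)

      cover-disjoint : AllPairs Disjoint cover
      cover-disjoint = AllPairsₚ.map⁺ (AllPairs.map inside
        (AllPairs-fiber (AllPairsₚ.map⁻ (proj₂ (Unique-concat⁻ (map seg gs) distinct)))))
        where
        inside : ∀ {p q} → Disjoint (seg (u , p)) (seg (u , q)) → Disjoint (path p) (path q)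
        inside d (v∈ , v∈′) = d (∈-map⁺ (u ,_) v∈ , ∈-map⁺ (u ,_) v∈′)

      isPath : ∀ {p} → p ∈ fiber gs → IsPath (H u) (path p)
      isPath p∈ = mkPath (s≤s z≤n) (All.lookup linked g∈)
        (Uniqueₚ.map⁻ (All.lookup (proj₁ (Unique-concat⁻ (map seg gs) distinct)) (∈-map⁺ seg g∈)))
        where g∈ = ∈-fiber⁻ gs p∈

      covered : ∀ v → Any (v ∈_) cover
      covered v with (w , p) , g∈ , v∈ ← find (∈-concatMap⁻ seg {xs = gs} (covers (u , v)))
        with _ , v∈p , refl ← ∈-map⁻ (w ,_) v∈ = lose (∈-map⁺ path (∈-fiber⁺ {l = gs} g∈)) v∈p

      isPathCover : IsPathCover (H u) cover
      isPathCover = mkPathCover (Allₚ.map⁺ (All.tabulate isPath)) cover-disjoint covered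

      -- One label per run in part `u`; they are distinct because the runs have distinct starts, so
      -- the covered count bounds the number of runs.
      labels : List (Fin (order (H u)))
      labels = map (Inverse.to (H.enum u) ∘ proj₁) (fiber gs)

      labels-unique : Unique labels
      labels-unique = AllPairsₚ.map⁺ (AllPairs.map (λ ne eq → ne (relabel-injective (cong (u ,_) eq)))
        (AllPairs-fiber (AllPairsₚ.map⁻ starts)))

      labels-∈ : ∀ {x} → x ∈ labels → (u , x) ∈ map relabel (map start gs)
      labels-∈ x∈ with p , p∈ , refl ← ∈-map⁻ _ x∈ = ∈-map⁺ relabel (∈-map⁺ start (∈-fiber⁻ gs p∈))

      on-cycle : ∀ {x} → x ∈ labels →
                 x ∈ filter (λ x → any? (Digraph._∈?_ Q′ (u , x)) [ map relabel (map start gs) ])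
                            (Digraph.vertices (K̄ (order (H u))))
      on-cycle x∈ = ∈-filter⁺ _ (∈-vertices (K̄ (order (H u))) _) (here (labels-∈ x∈))

      cover≡ : length cover ≡ length labels
      cover≡ = trans (length-map path (fiber gs)) (sym (length-map _ (fiber gs)))

      labels≤ : length labels ≤ coveredIn T (K̄ ∘ order ∘ H) [ map relabel (map start gs) ] u
      labels≤ = unique-⊆⇒length≤ labels-unique on-cycle

      pc≤covered : pc (H u) ≤ coveredIn T (K̄ ∘ order ∘ H) [ map relabel (map start gs) ] u
      pc≤covered = ≤-trans (pc-minimal (H u) isPathCover) (≤-trans (≤-reflexive cover≡) labels≤)

    contract : ∀ {z ys} → Unique (z ∷ ys) → (∀ v → v ∈ z ∷ ys) → Grouping z ys z →
               ∃[ cs ] (IsCycleSubdigraph Q′ cs × (∀ u → pc (H u) ≤ coveredIn T (K̄ ∘ order ∘ H) cs u))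
    contract {z} uniq covers (mkGrouping run gs refl linked all-linked trail sub) =
      [ map relabel (map start gs⁺) ] ,
      (closed⇒cycle Q′ (closed (Trail-map relabel between trail)) (Uniqueₚ.map⁺ relabel-injective starts) ∷ [] ,
       [] ∷ []) ,
      pc≤covered gs⁺ uniq covers (linked ∷ all-linked) starts
      where
      gs⁺ : List Group
      gs⁺ = (proj₁ z , proj₂ z , run) ∷ gs
      starts : Unique (map start gs⁺)
      starts = AllPairs-resp-⊆ (refl ∷ sub) uniq

    other-part : (∀ u → 1 ≤ order (H u)) → ∀ (x : V Q) → ∃ λ (v : V Q) → proj₁ v ≢ proj₁ x
    other-part inhabited x = let w , w≢ = another T.enum two (proj₁ x) in (w , a-vertex (H w) (inhabited w)) , w≢

    -- The cycle is rotated to begin at the first vertex `z` outside the part of `x`. It then ends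
    -- inside that part, so its closing arc lies between parts.
    cut : (∀ u → 1 ≤ order (H u)) → HasHamiltonianCycle Q →
          ∃₂ λ z ys → Unique (z ∷ ys) × (∀ v → v ∈ z ∷ ys) × Grouping z ys z
    cut inhabited (_ , mkCycle {x} {xs} _ uniq l , covers) =
      let v , v≢ = other-part inhabited x in rotate v≢ (covers v)
      where
      rotate : ∀ {v} → proj₁ v ≢ proj₁ x → v ∈ x ∷ xs → _
      rotate v≢ (here refl) = contradiction refl v≢
      rotate v≢ (there v∈) with as , z , bs , refl , all-u , z≢ ← first-outside (proj₁ x) xs v∈ v≢ =
        let s , s′ = Trail-split as (Linked⇒Trail xs l)
            rotation = ++-comm (x ∷ as) (z ∷ bs)
        in z , bs ++ x ∷ as , Unique-resp-↭ rotation uniq , ∈-resp-↭ rotation ∘ covers ,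
           group (Trail-++ s′ s)
             λ eq → z≢ (trans (sym eq) (trans (cong proj₁ (endpoint-++ z bs)) (endpoint-part refl all-u)))

    forward : (∀ u → 1 ≤ order (H u)) → HasHamiltonianCycle Q →
              ∃[ cs ] (IsCycleSubdigraph Q′ cs × (∀ u → pc (H u) ≤ coveredIn T (K̄ ∘ order ∘ H) cs u))
    forward inhabited ham = let _ , _ , uniq , covers , G = cut inhabited ham in contract uniq covers G

  -- From a cycle subdigraph to a Hamiltonian cycle

  module Backward (two : 2 ≤ order T) (inhabited : ∀ u → 1 ≤ order (H u))
                  (semicomplete : Semicomplete T) (strong : Strong Q)
                  {cs : List (List (V Q′))} (cycles : IsCycleSubdigraph Q′ cs)
                  (enough : ∀ u → pc (H u) ≤ coveredIn T (K̄ ∘ order ∘ H) cs u) where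
    open Merging T semicomplete {V Q′} proj₁

    -- Its length is definitionally `coveredIn` at `u`, so `enough` bounds it directly.
    labels : ∀ u → List (Fin (order (H u)))
    labels u = filter (λ x → any? (Digraph._∈?_ Q′ (u , x)) cs) (Digraph.vertices (K̄ (order (H u))))

    labels⇒∈ : ∀ {u x} → x ∈ labels u → (u , x) ∈ concat cs
    labels⇒∈ {u} x∈ = ∈-concat⁺ (proj₂ (∈-filter⁻ _ {xs = Digraph.vertices (K̄ (order (H u)))} x∈))

    ∈⇒labels : ∀ {u x} → (u , x) ∈ concat cs → x ∈ labels u
    ∈⇒labels {u} {x} x∈ = ∈-filter⁺ _ (∈-vertices (K̄ (order (H u))) x) (∈-concat⁻ cs x∈)

    labels-unique : ∀ u → Unique (labels u)
    labels-unique u = Uniqueₚ.filter⁺ _ (vertices-unique (K̄ (order (H u))))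

    hamiltonian : ∃[ w ] (Closed _⇢_ w × w ↭ concat cs)
    hamiltonian = hamiltonian-walk (λ {P} → strong-invariant inhabited strong {P}) u₀
      (All.map to-closed (proj₁ cycles)) cover
      where
      u₀ : V T
      u₀ = a-vertex T (≤-trans (s≤s z≤n) two)
      to-closed : ∀ {c} → IsCycle Q′ c → Closed _⇢_ c
      to-closed c with closed t ← cycle⇒closed Q′ c =
        -- `K̄` has no arcs, so every arc of `Q′` lies between parts.
        closed (Trail-weaken (λ { (between uw) → uw }) t)
      cover : ∀ u → ∃[ a ] (a ∈ concat cs × proj₁ a ≡ u)
      cover u = let x , x∈ = nonempty-list (≤-trans (pc-positive (H u) (inhabited u)) (enough u))
                in (u , x) , labels⇒∈ x∈ , refl

    record Cover (u : V T) : Set where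
      field
        paths    : List (List (V (H u)))
        segments : All (Segment (H.Arc u)) paths
        size     : length paths ≡ length (labels u)
        distinct : Unique (concat paths)
        covers   : ∀ v → v ∈ concat paths

    path⇒segment : ∀ {u p} → IsPath (H u) p → Segment (H.Arc u) p
    path⇒segment {p = _ ∷ _} isPath = segment (IsPath.arcs isPath)

    -- Part `u` of `Q′` has as many vertices as `H u`, and `xs` contains all of the latter. This is
    -- the upper bound that `split-segments` needs.
    labels≤ : ∀ u {xs} → (∀ v → v ∈ xs) → length (labels u) ≤ length xs
    labels≤ u all∈ = ≤-trans (length-filter _ (Digraph.vertices (K̄ (order (H u)))))
      (≤-trans (≤-reflexive (trans (length-vertices (K̄ (order (H u)))) (sym (length-vertices (H u)))))
        (unique-⊆⇒length≤ (vertices-unique (H u)) (λ {v} _ → all∈ v)))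

    path-cover⇒Cover : ∀ {u k} → PathCoverable (H u) k → k ≤ length (labels u) → Cover u
    path-cover⇒Cover {u} (ps , refl , mkPathCover paths disjoint covers) le =
      let qs , segs , size , eq = split-segments ps (length (labels u)) (All.map path⇒segment paths)
                                    le (labels≤ u (∈-concat⁺ ∘ covers))
      in record
        { paths    = qs
        ; segments = segs
        ; size     = size
        ; distinct = subst Unique (sym eq) (Uniqueₚ.concat⁺ (All.map IsPath.distinct paths) disjoint)
        ; covers   = λ v → subst (v ∈_) (sym eq) (∈-concat⁺ (covers v))
        }

    -- Only the fields of `Cover` matter from here on; the exhaustive search behind `pc` is hidden.
    abstract
      cover : ∀ u → Cover u
      cover u = path-cover⇒Cover (proj₁ (pc-isSmallest (H u))) (enough u)

    module _ {u : V T} where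
      open Cover (cover u) public
      open Assign {B = V (H u)} (Fin._≟_ {order (H u)}) public

    seg : V Q′ → List (V Q)
    seg (u , x) = map (u ,_) (assign (labels u) paths x)

    -- Membership in `concat cs` makes the vertex a key; any other vertex gets the default empty
    -- list, which is no segment.
    seg-segment : ∀ {a} → a ∈ concat cs → Segment (CompositionArc T H) (seg a)
    seg-segment {u , x} a∈ = tag (assign-all size segments (∈⇒labels a∈))
      where
      tag : ∀ {p} → Segment (H.Arc u) p → Segment (CompositionArc T H) (map (u ,_) p)
      tag (segment l) = segment (Linkedₚ.map⁺ (Linked.map within l))

    seg-unique : ∀ a → Unique (seg a)
    seg-unique (u , x) = Uniqueₚ.map⁺ (λ { refl → refl })
      (assign-unique (labels u) (proj₁ (Unique-concat⁻ paths distinct)) x)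

    seg-disjoint : ∀ {a b} → a ≢ b → Disjoint (seg a) (seg b)
    seg-disjoint {u , x} {w , y} ne (v∈ , v∈′)
      with h , h∈ , refl ← ∈-map⁻ (u ,_) v∈ | _ , h∈′ , refl ← ∈-map⁻ (w ,_) v∈′ =
      assign-disjoint (labels u) (proj₂ (Unique-concat⁻ paths distinct)) (ne ∘ cong (u ,_)) (h∈ , h∈′)

    seg-arc : ∀ {a b x y} → a ⇢ b → x ∈ seg a → y ∈ seg b → CompositionArc T H x y
    seg-arc {u , _} {w , _} uw x∈ y∈
      with _ , _ , refl ← ∈-map⁻ (u ,_) x∈ | _ , _ , refl ← ∈-map⁻ (w ,_) y∈ = between uw

    cs-unique : Unique (concat cs)
    cs-unique = Uniqueₚ.concat⁺ (All.map (cycle⇒unique Q′) (proj₁ cycles)) (proj₂ cycles)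

    backward : HasHamiltonianCycle Q
    backward =
      let w , cw , p = hamiltonian
      in concatMap seg w ,
         closed⇒cycle Q (expand-closed seg seg-arc cw (All.tabulate (seg-segment ∘ ∈-resp-↭ p)))
           -- Merging preserved the multiset of vertices, so `w` repeats none and every path is
           -- inserted only once.
           (Uniqueₚ.concat⁺ (Allₚ.map⁺ (All.universal seg-unique w))
             (AllPairsₚ.map⁺ (AllPairs.map seg-disjoint (Unique-resp-↭ (↭-sym p) cs-unique)))) ,
         λ (u , h) →
           let x , x∈ , h∈ = assign-covers (labels-unique u) size (covers h)
           in ∈-concatMap⁺ seg (lose (∈-resp-↭ (↭-sym p) (labels⇒∈ x∈)) (∈-map⁺ (u ,_) h∈))

theorem4p3 : (T : Digraph) (H : V T → Digraph) →
    2 ≤ order T →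
    (∀ u → 1 ≤ order (H u)) →
    Semicomplete T →
    Strong (T ⟦ H ⟧) →
    HasHamiltonianCycle (T ⟦ H ⟧) ⇔
    (∃[ cs ] (IsCycleSubdigraph (T ⟦ K̄ ∘ order ∘ H ⟧) cs ×
    (∀ u → pc (H u) ≤ coveredIn T (K̄ ∘ order ∘ H) cs u)))
theorem4p3 T H two inhabited semicomplete strong = mk⇔
  (Forward.forward T H two inhabited)
  (λ (_ , cycles , enough) → Backward.backward T H two inhabited semicomplete strong cycles enough)
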